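{- For every integer $k\ge1$ there is a constant $C_k>0$, depending only on $k$, such that for all integers $B\ge2$, $$N_k(B)\le C_k\,B^{k+1}(\log B)^{k^2+2k-2},$$ where $N_k(B)$ denotes the number of solutions of the equation $n_1n_2\cdots n_{k+1}=n_{k+2}n_{k+3}\cdots n_{2(k+1)}$ in integers $n_i$ with $1\le n_i\le B$ for $1\le i\le 2(k+1)$. -}

module Defs where

open import Data.Integer.Base as ℤ using (+_; +[1+_]; -[1+_]; +<+)
import Data.Integer.Properties as ℤ
open import Data.List.Base as List using (List; []; _∷_; applyUpTo; cartesianProductWith; filter; length)
open import Data.Nat.Base as ℕ using (ℕ; zero; suc)
open import Data.Nat.ListAction using (product)
import Data.Nat.Properties as ℕ
import Data.Nat.Solver as ℕSolver
open import Data.Product.Base using (∃; _×_; _,_; proj₁; proj₂)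
open import Data.Rational.Base
import Data.Rational.Properties as ℚ
open import Data.Rational.Solver using (module +-*-Solver)
import Data.Rational.Unnormalised.Base as ℚᵘ
import Data.Rational.Unnormalised.Properties as ℚᵘ
open import Data.Sum.Base using (inj₁; inj₂)
open import Data.Vec.Base as Vec using (Vec; []; _∷_; take; drop; toList)
open import Relation.Unary using (Decidable)
open import Relation.Binary.PropositionalEquality

------------------------------------------------------------------------
-- Rational arithmetic

∣p∣< : ∀ {p q} → p < q → - p < q → ∣ p ∣ < q
∣p∣< {p} p<q -p<q with ℚ.∣p∣≡p∨∣p∣≡-p p
... | inj₁ eq = subst (_< _) (sym eq) p<q
... | inj₂ eq = subst (_< _) (sym eq) -p<q

≤-sub : ∀ {p q r} → p ≤ q + r → p - q ≤ r
≤-sub {p} {q} {r} h = subst (p - q ≤_) (lemma q r) (ℚ.+-monoˡ-≤ (- q) h)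
  where
  open +-*-Solver
  lemma : ∀ q r → q + r - q ≡ r
  lemma = solve 2 (λ q r → q :+ r :- q := r) refl

neg-sub : ∀ p q → - (p - q) ≡ q - p
neg-sub = solve 2 (λ p q → :- (p :- q) := q :- p) refl
  where open +-*-Solver

≤-cancelʳ : ∀ {p q} r → p + r ≤ q + r → p ≤ q
≤-cancelʳ {p} {q} r h = subst₂ _≤_ (lemma p r) (lemma q r) (ℚ.+-monoˡ-≤ (- r) h)
  where
  open +-*-Solver
  lemma : ∀ p r → p + r - r ≡ p
  lemma = solve 2 (λ p r → p :+ r :- r := p) refl

-- unitFraction n = 1/(n+1)
unitFraction : ℕ → ℚ
unitFraction n = + 1 / suc n

natℚ : ℕ → ℚ
natℚ n = + n / 1

natℚ-suc : ∀ n → natℚ (suc n) ≡ 1ℚ + natℚ n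
natℚ-suc n = ℚ.toℚᵘ-injective (begin
  toℚᵘ (natℚ (suc n))                    ≈⟨ ℚ.toℚᵘ-fromℚᵘ (ℚᵘ.mkℚᵘ (+ suc n) 0) ⟩
  ℚᵘ.mkℚᵘ (+ suc n) 0                    ≈⟨ ℚᵘ.*≡* lemma ⟩
  ℚᵘ.mkℚᵘ (+ 1) 0 ℚᵘ.+ ℚᵘ.mkℚᵘ (+ n) 0   ≈⟨ ℚᵘ.+-congʳ (toℚᵘ 1ℚ) (ℚ.toℚᵘ-fromℚᵘ (ℚᵘ.mkℚᵘ (+ n) 0)) ⟨
  toℚᵘ 1ℚ ℚᵘ.+ toℚᵘ (natℚ n)             ≈⟨ ℚ.toℚᵘ-homo-+ 1ℚ (natℚ n) ⟨
  toℚᵘ (1ℚ + natℚ n)                     ∎)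
  where
  open import Relation.Binary.Reasoning.Setoid ℚᵘ.≃-setoid
  lemma : + suc n ℤ.* + 1 ≡ (+ 1 ℤ.+ + n ℤ.* + 1) ℤ.* + 1
  lemma = cong (λ z → (+ 1 ℤ.+ z) ℤ.* + 1) (sym (ℤ.*-identityʳ (+ n)))

unitFraction-anti-≤ : ∀ {m n} → m ℕ.≤ n → unitFraction n ≤ unitFraction m
unitFraction-anti-≤ {m} {n} m≤n = ℚ.toℚᵘ-cancel-≤ (begin
  toℚᵘ (unitFraction n)   ≃⟨ ℚ.toℚᵘ-fromℚᵘ (ℚᵘ.mkℚᵘ (+ 1) n) ⟩
  ℚᵘ.mkℚᵘ (+ 1) n         ≤⟨ ℚᵘ.*≤* (ℤ.*-monoˡ-≤-nonNeg (+ 1) (ℤ.+≤+ (ℕ.s≤s m≤n))) ⟩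
  ℚᵘ.mkℚᵘ (+ 1) m         ≃⟨ ℚ.toℚᵘ-fromℚᵘ (ℚᵘ.mkℚᵘ (+ 1) m) ⟨
  toℚᵘ (unitFraction m)   ∎)
  where open ℚᵘ.≤-Reasoning

natℚ*unitFraction : ∀ m n k → suc k ≡ n ℕ.* suc m → natℚ n * unitFraction k ≡ unitFraction m
natℚ*unitFraction m n k eq = ℚ.toℚᵘ-injective (begin
  toℚᵘ (natℚ n * unitFraction k)            ≈⟨ ℚ.toℚᵘ-homo-* (natℚ n) (unitFraction k) ⟩
  toℚᵘ (natℚ n) ℚᵘ.* toℚᵘ (unitFraction k)  ≈⟨ ℚᵘ.*-cong (ℚ.toℚᵘ-fromℚᵘ (ℚᵘ.mkℚᵘ (+ n) 0))
                                                         (ℚ.toℚᵘ-fromℚᵘ (ℚᵘ.mkℚᵘ (+ 1) k)) ⟩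
  ℚᵘ.mkℚᵘ (+ n) 0 ℚᵘ.* ℚᵘ.mkℚᵘ (+ 1) k      ≈⟨ ℚᵘ.*≡* lemma ⟩
  ℚᵘ.mkℚᵘ (+ 1) m                           ≈⟨ ℚ.toℚᵘ-fromℚᵘ (ℚᵘ.mkℚᵘ (+ 1) m) ⟨
  toℚᵘ (unitFraction m)                     ∎)
  where
  open import Relation.Binary.Reasoning.Setoid ℚᵘ.≃-setoid
  lemma : (+ n ℤ.* + 1) ℤ.* + suc m ≡ + 1 ℤ.* + (1 ℕ.* suc k)
  lemma = trans (cong (ℤ._* + suc m) (ℤ.*-identityʳ (+ n)))
         (trans (sym (ℤ.pos-* n (suc m)))
         (trans (cong +_ (trans (sym eq) (sym (ℕ.*-identityˡ (suc k)))))
                (sym (ℤ.*-identityˡ _))))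

archimedean : ∀ ε → 0ℚ < ε → ∃ λ n → unitFraction n < ε
archimedean ε@(mkℚ (+ zero) d _) (*<* (+<+ ()))
archimedean ε@(mkℚ -[1+ _ ] d _) (*<* ())
archimedean ε@(mkℚ +[1+ p ] d _) _ = suc d , ℚ.toℚᵘ-cancel-< (begin-strict
  toℚᵘ (unitFraction (suc d))   ≃⟨ ℚ.toℚᵘ-fromℚᵘ (ℚᵘ.mkℚᵘ (+ 1) (suc d)) ⟩
  ℚᵘ.mkℚᵘ (+ 1) (suc d)         <⟨ ℚᵘ.*<* lemma ⟩
  toℚᵘ ε                        ∎)
  where
  open ℚᵘ.≤-Reasoning
  lemma : + 1 ℤ.* + suc d ℤ.< + suc p ℤ.* + suc (suc d)
  lemma = subst₂ ℤ._<_ (sym (ℤ.*-identityˡ (+ suc d))) (ℤ.pos-* (suc p) (suc (suc d)))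
    (+<+ (ℕ.m≤m+n (suc (suc d)) (p ℕ.* suc (suc d))))

------------------------------------------------------------------------
-- Real numbers: Cauchy sequences of rationals

record ℝ : Set where
  constructor mkℝ
  field
    seq    : ℕ → ℚ
    cauchy : ∀ ε → 0ℚ < ε → ∃ λ M → ∀ m n → M ℕ.≤ m → M ℕ.≤ n → ∣ seq m - seq n ∣ < ε

open ℝ public

infix  4 _≤ᵣ_ _<ᵣ_
infixl 7 _*ᵣ_
infixr 8 _^ᵣ_

_≤ᵣ_ : ℝ → ℝ → Set
x ≤ᵣ y = ∀ ε → 0ℚ < ε → ∃ λ M → ∀ m → M ℕ.≤ m → seq x m ≤ seq y m + ε

_<ᵣ_ : ℝ → ℝ → Set
x <ᵣ y = ∃ λ ε → 0ℚ < ε × ∃ λ M → ∀ m → M ℕ.≤ m → seq x m + ε ≤ seq y m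

fromℚ : ℚ → ℝ
fromℚ q = mkℝ (λ _ → q) λ ε 0<ε → 0 , λ _ _ _ _ → subst (λ z → ∣ z ∣ < ε) (sym (ℚ.+-inverseʳ q)) 0<ε

fromℕ : ℕ → ℝ
fromℕ n = fromℚ (natℚ n)

eventuallyBounded : ∀ x → ∃ λ K → 0ℚ < K × ∃ λ M → ∀ m → M ℕ.≤ m → ∣ seq x m ∣ ≤ K
eventuallyBounded x with cauchy x 1ℚ (ℚ.positive⁻¹ 1ℚ)
... | M , close = K , ℚ.<-≤-trans (ℚ.positive⁻¹ 1ℚ) 1≤K , M , bound
  where
  K = 1ℚ + ∣ seq x M ∣
  1≤K : 1ℚ ≤ K
  1≤K = subst (_≤ K) (ℚ.+-identityʳ 1ℚ) (ℚ.+-monoʳ-≤ 1ℚ (ℚ.0≤∣p∣ (seq x M)))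
  split : ∀ p q → (p - q) + q ≡ p
  split = solve 2 (λ p q → (p :- q) :+ q := p) refl
    where open +-*-Solver
  open ℚ.≤-Reasoning
  bound : ∀ m → M ℕ.≤ m → ∣ seq x m ∣ ≤ K
  bound m M≤m = begin
    ∣ seq x m ∣                                ≡⟨ cong ∣_∣ (split (seq x m) (seq x M)) ⟨
    ∣ (seq x m - seq x M) + seq x M ∣          ≤⟨ ℚ.∣p+q∣≤∣p∣+∣q∣ (seq x m - seq x M) (seq x M) ⟩
    ∣ seq x m - seq x M ∣ + ∣ seq x M ∣        ≤⟨ ℚ.+-monoˡ-≤ ∣ seq x M ∣ (ℚ.<⇒≤ (close m M M≤m ℕ.≤-refl)) ⟩
    K                                          ∎

scaled : ∀ ε K → 0ℚ < ε → 0ℚ < K → ∃ λ δ → 0ℚ < δ × K * δ ≡ ε * ½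
scaled ε K 0<ε 0<K = δ , ℚ.positive⁻¹ δ , (begin
  K * (ε * ½ * 1/ K)     ≡⟨ shuffle K (ε * ½) (1/ K) ⟩
  (K * 1/ K) * (ε * ½)   ≡⟨ cong (_* (ε * ½)) (ℚ.*-inverseʳ K) ⟩
  1ℚ * (ε * ½)           ≡⟨ ℚ.*-identityˡ (ε * ½) ⟩
  ε * ½                  ∎)
  where
  open ≡-Reasoning
  instance
    εpos : Positive ε
    εpos = positive 0<ε
    Kpos : Positive K
    Kpos = positive 0<K
    Knz : NonZero K
    Knz = ℚ.pos⇒nonZero K
    1/Kpos : Positive (1/ K)
    1/Kpos = ℚ.1/pos⇒pos K
    ε½pos : Positive (ε * ½)
    ε½pos = ℚ.pos*pos⇒pos ε ½
  δ = ε * ½ * 1/ K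
  instance
    δpos : Positive δ
    δpos = ℚ.pos*pos⇒pos (ε * ½) (1/ K)
  shuffle : ∀ k e i → k * (e * i) ≡ (k * i) * e
  shuffle = solve 3 (λ k e i → k :* (e :* i) := (k :* i) :* e) refl
    where open +-*-Solver

∣p*q∣-bound : ∀ {p q K δ} → 0ℚ < K → ∣ p ∣ ≤ K → ∣ q ∣ < δ → ∣ p * q ∣ < K * δ
∣p*q∣-bound {p} {q} {K} {δ} 0<K p≤K q<δ = begin-strict
  ∣ p * q ∣       ≡⟨ ℚ.∣p*q∣≡∣p∣*∣q∣ p q ⟩
  ∣ p ∣ * ∣ q ∣   ≤⟨ ℚ.*-monoʳ-≤-nonNeg ∣ q ∣ {{ℚ.∣-∣-nonNeg q}} p≤K ⟩
  K * ∣ q ∣       <⟨ ℚ.*-monoʳ-<-pos K {{positive 0<K}} q<δ ⟩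
  K * δ           ∎
  where open ℚ.≤-Reasoning

halves : ∀ ε → ε * ½ + ε * ½ ≡ ε
halves ε = begin
  ε * ½ + ε * ½   ≡⟨ ℚ.*-distribˡ-+ ε ½ ½ ⟨
  ε * (½ + ½)     ≡⟨ cong (ε *_) ½+½≡1ℚ ⟩
  ε * 1ℚ          ≡⟨ ℚ.*-identityʳ ε ⟩
  ε               ∎
  where
  open ≡-Reasoning
  ½+½≡1ℚ : ½ + ½ ≡ 1ℚ
  ½+½≡1ℚ = refl

product-close : ∀ {a b c d K L δ η ε} → 0ℚ < K → 0ℚ < L →
  ∣ a ∣ ≤ K → ∣ b - d ∣ < δ → ∣ d ∣ ≤ L → ∣ a - c ∣ < η →
  K * δ ≡ ε * ½ → L * η ≡ ε * ½ → ∣ a * b - c * d ∣ < ε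
product-close {a} {b} {c} {d} {K} {L} {δ} {η} {ε} 0<K 0<L a≤K b-d<δ d≤L a-c<η Kδ≡ Lη≡ = begin-strict
  ∣ a * b - c * d ∣                   ≡⟨ cong ∣_∣ (expand a b c d) ⟩
  ∣ a * (b - d) + d * (a - c) ∣       ≤⟨ ℚ.∣p+q∣≤∣p∣+∣q∣ (a * (b - d)) (d * (a - c)) ⟩
  ∣ a * (b - d) ∣ + ∣ d * (a - c) ∣   <⟨ ℚ.+-mono-< (∣p*q∣-bound {a} {b - d} {K} {δ} 0<K a≤K b-d<δ)
                                                   (∣p*q∣-bound {d} {a - c} {L} {η} 0<L d≤L a-c<η) ⟩
  K * δ + L * η                       ≡⟨ cong₂ _+_ Kδ≡ Lη≡ ⟩
  ε * ½ + ε * ½                       ≡⟨ halves ε ⟩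
  ε                                   ∎
  where
  open ℚ.≤-Reasoning
  expand : ∀ a b c d → a * b - c * d ≡ a * (b - d) + d * (a - c)
  expand = solve 4 (λ a b c d → a :* b :- c :* d := a :* (b :- d) :+ d :* (a :- c)) refl
    where open +-*-Solver

*ᵣ-cauchy : ∀ x y ε → 0ℚ < ε →
  ∃ λ M → ∀ m n → M ℕ.≤ m → M ℕ.≤ n → ∣ seq x m * seq y m - seq x n * seq y n ∣ < ε
*ᵣ-cauchy x y ε 0<ε =
  let K , 0<K , M₁ , boundx = eventuallyBounded x
      L , 0<L , M₂ , boundy = eventuallyBounded y
      δ , 0<δ , Kδ≡ = scaled ε K 0<ε 0<K
      η , 0<η , Lη≡ = scaled ε L 0<ε 0<L
      M₃ , closey = cauchy y δ 0<δ
      M₄ , closex = cauchy x η 0<η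
      M₁≤ = λ {m} h → ℕ.≤-trans {M₁} {_} {m} (ℕ.m≤m⊔n M₁ M₂) (ℕ.m⊔n≤o⇒m≤o (M₁ ℕ.⊔ M₂) (M₃ ℕ.⊔ M₄) h)
      M₂≤ = λ {m} h → ℕ.≤-trans {M₂} {_} {m} (ℕ.m≤n⊔m M₁ M₂) (ℕ.m⊔n≤o⇒m≤o (M₁ ℕ.⊔ M₂) (M₃ ℕ.⊔ M₄) h)
      M₃≤ = λ {m} h → ℕ.≤-trans {M₃} {_} {m} (ℕ.m≤m⊔n M₃ M₄) (ℕ.m⊔n≤o⇒n≤o (M₁ ℕ.⊔ M₂) (M₃ ℕ.⊔ M₄) h)
      M₄≤ = λ {m} h → ℕ.≤-trans {M₄} {_} {m} (ℕ.m≤n⊔m M₃ M₄) (ℕ.m⊔n≤o⇒n≤o (M₁ ℕ.⊔ M₂) (M₃ ℕ.⊔ M₄) h)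
  in (M₁ ℕ.⊔ M₂) ℕ.⊔ (M₃ ℕ.⊔ M₄) , λ m n M≤m M≤n →
     product-close {seq x m} {seq y m} {seq x n} {seq y n} {K} {L} {δ} {η} {ε} 0<K 0<L
       (boundx m (M₁≤ M≤m)) (closey m n (M₃≤ M≤m) (M₃≤ M≤n))
       (boundy n (M₂≤ M≤n)) (closex m n (M₄≤ M≤m) (M₄≤ M≤n)) Kδ≡ Lη≡

_*ᵣ_ : ℝ → ℝ → ℝ
x *ᵣ y = mkℝ (λ m → seq x m * seq y m) (*ᵣ-cauchy x y)

_^ᵣ_ : ℝ → ℕ → ℝ
x ^ᵣ zero  = fromℚ 1ℚ
x ^ᵣ suc n = x *ᵣ x ^ᵣ n

------------------------------------------------------------------------
-- The natural logarithm of a positive integer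

-- reciprocalSum a l = 1/(a+1) + 1/(a+2) + ⋯ + 1/(a+l)
reciprocalSum : ℕ → ℕ → ℚ
reciprocalSum a zero    = 0ℚ
reciprocalSum a (suc l) = reciprocalSum a l + unitFraction (a ℕ.+ l)

-- The right-endpoint (here: lower) Riemann sum of ∫₁ⁿ dt/t with mesh 1/M is
--   Σ_{i=1}^{M(n-1)} (1/M) · 1/(1 + i/M) = Σ_{i=1}^{M(n-1)} 1/(M + i).
lowerSum : ℕ → ℕ → ℚ
lowerSum n M = reciprocalSum M (M ℕ.* (n ℕ.∸ 1))

reciprocalSum-++ : ∀ a l k → reciprocalSum a (l ℕ.+ k) ≡ reciprocalSum a l + reciprocalSum (a ℕ.+ l) k
reciprocalSum-++ a l zero = trans (cong (reciprocalSum a) (ℕ.+-identityʳ l)) (sym (ℚ.+-identityʳ _))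
reciprocalSum-++ a l (suc k) = begin
  reciprocalSum a (l ℕ.+ suc k)
    ≡⟨ cong (reciprocalSum a) (ℕ.+-suc l k) ⟩
  reciprocalSum a (l ℕ.+ k) + unitFraction (a ℕ.+ (l ℕ.+ k))
    ≡⟨ cong₂ (λ s i → s + unitFraction i) (reciprocalSum-++ a l k) (sym (ℕ.+-assoc a l k)) ⟩
  reciprocalSum a l + reciprocalSum (a ℕ.+ l) k + unitFraction (a ℕ.+ l ℕ.+ k)
    ≡⟨ ℚ.+-assoc (reciprocalSum a l) (reciprocalSum (a ℕ.+ l) k) _ ⟩
  reciprocalSum a l + reciprocalSum (a ℕ.+ l) (suc k) ∎
  where open ≡-Reasoning

reciprocalSum-suc : ∀ a l → reciprocalSum a (suc l) ≡ unitFraction a + reciprocalSum (suc a) l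
reciprocalSum-suc a l = begin
  reciprocalSum a (suc l)                              ≡⟨ reciprocalSum-++ a 1 l ⟩
  0ℚ + unitFraction (a ℕ.+ 0) + reciprocalSum (a ℕ.+ 1) l
    ≡⟨ cong₂ _+_ (trans (ℚ.+-identityˡ _) (cong unitFraction (ℕ.+-identityʳ a)))
                 (cong (λ z → reciprocalSum z l) (ℕ.+-comm a 1)) ⟩
  unitFraction a + reciprocalSum (suc a) l             ∎
  where open ≡-Reasoning

reciprocalSum-≤ : ∀ a l → reciprocalSum a l ≤ natℚ l * unitFraction a
reciprocalSum-≤ a zero    = ℚ.≤-reflexive (sym (ℚ.*-zeroˡ (unitFraction a)))
reciprocalSum-≤ a (suc l) = begin
  reciprocalSum a l + unitFraction (a ℕ.+ l)    ≤⟨ ℚ.+-mono-≤ (reciprocalSum-≤ a l) (unitFraction-anti-≤ (ℕ.m≤m+n a l)) ⟩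
  natℚ l * unitFraction a + unitFraction a      ≡⟨ lemma (natℚ l) (unitFraction a) ⟩
  (1ℚ + natℚ l) * unitFraction a                ≡⟨ cong (_* unitFraction a) (natℚ-suc l) ⟨
  natℚ (suc l) * unitFraction a                 ∎
  where
  open ℚ.≤-Reasoning
  lemma : ∀ n u → n * u + u ≡ (1ℚ + n) * u
  lemma = solve 2 (λ n u → n :* u :+ u := (con 1ℚ :+ n) :* u) refl
    where open +-*-Solver

reciprocalSum-≥ : ∀ a b l → a ℕ.+ l ℕ.≤ suc b → natℚ l * unitFraction b ≤ reciprocalSum a l
reciprocalSum-≥ a b zero    _ = ℚ.≤-reflexive (ℚ.*-zeroˡ (unitFraction b))
reciprocalSum-≥ a b (suc l) h = begin
  natℚ (suc l) * unitFraction b                 ≡⟨ cong (_* unitFraction b) (natℚ-suc l) ⟩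
  (1ℚ + natℚ l) * unitFraction b                ≡⟨ lemma (natℚ l) (unitFraction b) ⟩
  natℚ l * unitFraction b + unitFraction b      ≤⟨ ℚ.+-mono-≤ (reciprocalSum-≥ a b l (ℕ.m≤n⇒m≤1+n a+l≤b)) (unitFraction-anti-≤ a+l≤b) ⟩
  reciprocalSum a l + unitFraction (a ℕ.+ l)    ∎
  where
  open ℚ.≤-Reasoning
  a+l≤b : a ℕ.+ l ℕ.≤ b
  a+l≤b = ℕ.s≤s⁻¹ (subst (ℕ._≤ suc b) (ℕ.+-suc a l) h)
  lemma : ∀ n u → (1ℚ + n) * u ≡ n * u + u
  lemma = solve 2 (λ n u → (con 1ℚ :+ n) :* u := n :* u :+ u) refl
    where open +-*-Solver

module _ (n : ℕ) where

  private
    N : ℕ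
    N = n ℕ.∸ 1

    block : ℕ → ℚ
    block M = reciprocalSum (M ℕ.+ M ℕ.* N) (suc N)

    refine : ∀ M → lowerSum n (suc M) + unitFraction M ≡ lowerSum n M + block M
    refine M = begin
      reciprocalSum (suc M) (suc M ℕ.* N) + unitFraction M
        ≡⟨ ℚ.+-comm _ (unitFraction M) ⟩
      unitFraction M + reciprocalSum (suc M) (suc M ℕ.* N)
        ≡⟨ reciprocalSum-suc M (suc M ℕ.* N) ⟨
      reciprocalSum M (suc (suc M ℕ.* N))
        ≡⟨ cong (reciprocalSum M) (ℕ.+-comm (suc N) (M ℕ.* N)) ⟩
      reciprocalSum M (M ℕ.* N ℕ.+ suc N)
        ≡⟨ reciprocalSum-++ M (M ℕ.* N) (suc N) ⟩
      lowerSum n M + block M ∎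
      where open ≡-Reasoning

    block-≥ : ∀ M → unitFraction M ≤ block M
    block-≥ M = subst (_≤ block M)
      (natℚ*unitFraction M (suc N) (M ℕ.+ M ℕ.* N ℕ.+ N) (lemma M N))
      (reciprocalSum-≥ (M ℕ.+ M ℕ.* N) (M ℕ.+ M ℕ.* N ℕ.+ N) (suc N) (ℕ.≤-reflexive (ℕ.+-suc _ N)))
      where
      lemma : ∀ M N → suc (M ℕ.+ M ℕ.* N ℕ.+ N) ≡ suc N ℕ.* suc M
      lemma = solve 2 (λ M N → con 1 :+ (M :+ M :* N :+ N) := (con 1 :+ N) :* (con 1 :+ M)) refl
        where open ℕSolver.+-*-Solver

    block-≤ : ∀ m → block (suc m) ≤ unitFraction m
    block-≤ m = ℚ.≤-trans
      (reciprocalSum-≤ (suc m ℕ.+ suc m ℕ.* N) (suc N))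
      (subst (natℚ (suc N) * unitFraction (suc m ℕ.+ suc m ℕ.* N) ≤_)
        (natℚ*unitFraction m (suc N) (m ℕ.+ suc m ℕ.* N) (lemma m N))
        (ℚ.*-monoˡ-≤-nonNeg (natℚ (suc N)) {{ℚ.normalize-nonNeg (suc N) 1}}
          (unitFraction-anti-≤ (ℕ.n≤1+n (m ℕ.+ suc m ℕ.* N)))))
      where
      lemma : ∀ m N → suc (m ℕ.+ suc m ℕ.* N) ≡ suc N ℕ.* suc m
      lemma = solve 2 (λ m N → con 1 :+ (m :+ (con 1 :+ m) :* N) := (con 1 :+ N) :* (con 1 :+ m)) refl
        where open ℕSolver.+-*-Solver

  lowerSum-step : ∀ M → lowerSum n M ≤ lowerSum n (suc M)
  lowerSum-step M = ≤-cancelʳ (unitFraction M)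
    (subst (lowerSum n M + unitFraction M ≤_) (sym (refine M)) (ℚ.+-monoʳ-≤ (lowerSum n M) (block-≥ M)))

  upper-step : ∀ m → lowerSum n (suc (suc m)) + unitFraction (suc m) ≤ lowerSum n (suc m) + unitFraction m
  upper-step m = subst (_≤ lowerSum n (suc m) + unitFraction m) (sym (refine (suc m)))
    (ℚ.+-monoʳ-≤ (lowerSum n (suc m)) (block-≤ m))

  lowerSum-mono : ∀ M j → lowerSum n M ≤ lowerSum n (j ℕ.+ M)
  lowerSum-mono M zero    = ℚ.≤-refl
  lowerSum-mono M (suc j) = ℚ.≤-trans (lowerSum-mono M j) (lowerSum-step (j ℕ.+ M))

  upper-anti : ∀ m j → lowerSum n (suc (j ℕ.+ m)) + unitFraction (j ℕ.+ m) ≤ lowerSum n (suc m) + unitFraction m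
  upper-anti m zero    = ℚ.≤-refl
  upper-anti m (suc j) = ℚ.≤-trans (upper-step (j ℕ.+ m)) (upper-anti m j)

  lowerSum-close : ∀ {p q} → p ℕ.≤ q → lowerSum n (suc q) ≤ lowerSum n (suc p) + unitFraction p
  lowerSum-close {p} {q} p≤q = subst (λ z → lowerSum n (suc z) ≤ lowerSum n (suc p) + unitFraction p)
    (ℕ.m∸n+n≡m p≤q)
    (ℚ.≤-trans (subst (_≤ lowerSum n (suc (j ℕ.+ p)) + unitFraction (j ℕ.+ p)) (ℚ.+-identityʳ _)
                 (ℚ.+-monoʳ-≤ (lowerSum n (suc (j ℕ.+ p)))
                   (ℚ.nonNegative⁻¹ (unitFraction (j ℕ.+ p)) {{ℚ.normalize-nonNeg 1 (suc (j ℕ.+ p))}})))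
               (upper-anti p j))
    where j = q ℕ.∸ p

-- log n = ∫₁ⁿ dt/t as the limit of its lower Riemann sums of mesh 1/(m+1);
-- only meaningful for n ≥ 1 (the value at n = 0 is 0).
log : ℕ → ℝ
seq    (log n) m = lowerSum n (suc m)
cauchy (log n) ε 0<ε with archimedean ε 0<ε
... | M , 1/M<ε = M , λ p q M≤p M≤q →
  ∣p∣< (ℚ.≤-<-trans (below q p M≤q) 1/M<ε)
       (subst (_< ε) (sym (neg-sub (L p) (L q))) (ℚ.≤-<-trans (below p q M≤p) 1/M<ε))
  where
  L : ℕ → ℚ
  L m = lowerSum n (suc m)
  mono : ∀ {p q} → p ℕ.≤ q → L p ≤ L q
  mono {p} {q} p≤q = subst (λ z → L p ≤ lowerSum n z)
    (trans (ℕ.+-suc (q ℕ.∸ p) p) (cong suc (ℕ.m∸n+n≡m p≤q))) (lowerSum-mono n (suc p) (q ℕ.∸ p))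
  below : ∀ p q → M ℕ.≤ p → L q - L p ≤ unitFraction M
  below p q M≤p with ℕ.≤-total p q
  ... | inj₁ p≤q = ≤-sub (ℚ.≤-trans (lowerSum-close n p≤q) (ℚ.+-monoʳ-≤ (L p) (unitFraction-anti-≤ M≤p)))
  ... | inj₂ q≤p = ≤-sub (ℚ.≤-trans (mono q≤p) (subst (_≤ L p + unitFraction M) (ℚ.+-identityʳ (L p))
                     (ℚ.+-monoʳ-≤ (L p) (ℚ.nonNegative⁻¹ (unitFraction M) {{ℚ.normalize-nonNeg 1 (suc M)}}))))

------------------------------------------------------------------------
-- The counting function

-- All vectors with entries in {1, …, B}, each listed exactly once.
box : ℕ → ∀ m → List (Vec ℕ m)
box B zero    = [] ∷ []
box B (suc m) = cartesianProductWith _∷_ (applyUpTo suc B) (box B m)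

IsSolution : ∀ k → Vec ℕ (2 ℕ.* (k ℕ.+ 1)) → Set
IsSolution k n = product (toList (take (k ℕ.+ 1) n)) ≡ product (toList (drop (k ℕ.+ 1) n))

isSolution? : ∀ k → Decidable (IsSolution k)
isSolution? k n = product (toList (take (k ℕ.+ 1) n)) ℕ.≟ product (toList (drop (k ℕ.+ 1) n))

solutionCount : ℕ → ℕ → ℕ
solutionCount k B = length (filter (isSolution? k) (box B (2 ℕ.* (k ℕ.+ 1))))

{-# OPTIONS --safe #-}
-- For k ≥ 2, a solution is given by the row and column products of a matrix of positive
-- integers, so N_k(B) is at most the (k+1)-st power of the number of (k+1)-tuples with product
-- at most B, which is at most B H^k for the harmonic number H of B.  The resulting exponent
-- k² + k of H is at most k² + 2k - 2.  For k = 1 this loses a factor H; instead, ab = cd forces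
-- a = gx, b = yh, c = gy, d = xh, and for given x, y there are at most B² / max(x, y)² choices
-- of g and h.  Finally H ≤ 3 log B, already for every lower Riemann sum of log B.
module Submission where

open import Defs
open import Data.Nat.Base using (ℕ; _≤_; _+_; _*_; _∸_; _^_; zero; suc; _<_; _/_; _!; NonZero; ≢-nonZero; ≢-nonZero⁻¹; s≤s; z≤n)
open import Data.Product.Base using (∃; _×_; _,_; uncurry)
open import Data.List.Base using (List; []; _∷_; _++_; map; concat; length; applyUpTo; cartesianProduct; cartesianProductWith)
open import Data.List.Membership.Propositional using (_∈_)
open import Data.List.Membership.Propositional.Properties
open import Data.List.Properties using (length-map; length-++; length-applyUpTo)
open import Data.List.Relation.Binary.Subset.Propositional using (_⊆_)
import Data.List.Relation.Unary.All as All
open import Data.List.Relation.Unary.AllPairs using ([]; _∷_)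
open import Data.List.Relation.Unary.Any using (here; there)
open import Data.List.Relation.Unary.Unique.Propositional using (Unique)
import Data.List.Relation.Unary.Unique.Propositional.Properties as Unique
open import Data.Nat.Coprimality using (coprime-/gcd; coprime-divisor)
open import Data.Nat.Divisibility using (_∣_; divides; ∣-trans; m∣m*n; m≤n⇒m!∣n!)
open import Data.Nat.DivMod using (m/n*n≡m; m*[n/m]≡n; m/n*n≤m; m/n≤m; m*n/n≡m; /-monoˡ-≤)
open import Data.Nat.GCD using (gcd; gcd[m,n]∣m; gcd[m,n]∣n; gcd[m,n]≢0)
open import Data.Nat.ListAction using (sum; product)
open import Data.Nat.Properties
import Data.Integer.Base as ℤ
import Data.Integer.Properties as ℤ
open import Data.Rational.Base as ℚ using (0ℚ; 1ℚ)
import Data.Rational.Properties as ℚ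
import Data.Rational.Solver as ℚ
import Data.Rational.Unnormalised.Base as ℚᵘ
import Data.Rational.Unnormalised.Properties as ℚᵘ
import Algebra.Bundles
open import Algebra.Properties.CommutativeSemiring.Exp
  (Algebra.Bundles.CommutativeRing.commutativeSemiring ℚ.+-*-commutativeRing)
  using () renaming (_^_ to _^ℚ_; ^-distrib-* to ^ℚ-distrib-*)
open import Algebra.Properties.CommutativeSemigroup *-commutativeSemigroup using (x∙yz≈y∙xz)
open import Data.Nat.Solver using (module +-*-Solver)
open import Data.Sum.Base using (inj₁; inj₂)
open import Data.Vec.Base as Vec using (Vec; []; _∷_; toList; replicate; zipWith; take; drop)
open import Data.Vec.Properties using (∷-injective; take++drop≡id)
open import Function.Base using (_∘_; const; it)
open import Relation.Nullary.Negation using (contradiction)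
open import Relation.Binary.PropositionalEquality

prod : ∀ {m} → Vec ℕ m → ℕ
prod v = product (toList v)

-- Covering a finite set by a list

-- Induction on `xs`: delete one occurrence of the head `x` from `ys`. Uniqueness keeps the tail of
-- `xs` inside what is left.
unique∧⊆⇒length≤ : ∀ {A : Set} {xs ys : List A} → Unique xs → xs ⊆ ys → length xs ≤ length ys
unique∧⊆⇒length≤ [] _ = z≤n
unique∧⊆⇒length≤ {A} {x ∷ xs} (x∉xs ∷ u) xs⊆ys with ∈-∃++ (xs⊆ys (here refl))
... | ys , zs , refl = begin
  suc (length xs)              ≤⟨ s≤s (unique∧⊆⇒length≤ u xs⊆) ⟩
  suc (length (ys ++ zs))      ≡⟨ cong suc (length-++ ys) ⟩
  suc (length ys + length zs)  ≡⟨ +-suc (length ys) (length zs) ⟨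
  length ys + suc (length zs)  ≡⟨ length-++ ys ⟨
  length (ys ++ x ∷ zs)        ∎
  where
  open ≤-Reasoning
  xs⊆ : xs ⊆ ys ++ zs
  xs⊆ z∈xs with ∈-++⁻ ys (xs⊆ys (there z∈xs))
  ... | inj₁ z∈ys         = ∈-++⁺ˡ z∈ys
  ... | inj₂ (here refl)  = contradiction refl (All.lookup x∉xs z∈xs)
  ... | inj₂ (there z∈zs) = ∈-++⁺ʳ ys z∈zs

box-unique : ∀ B m → Unique (box B m)
box-unique B zero    = All.[] ∷ []
box-unique B (suc m) = Unique.cartesianProductWith⁺ _∷_ ∷-injective
  (Unique.applyUpTo⁺₁ suc B (λ i<j _ → <⇒≢ (s≤s i<j))) (box-unique B m)

∈-box-∷⁻ : ∀ {B m x} {v : Vec ℕ m} → x ∷ v ∈ box B (suc m) →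
  (∃ λ i → i < B × x ≡ suc i) × v ∈ box B m
∈-box-∷⁻ {B} {m} x∷v∈ with ∈-cartesianProductWith⁻ _∷_ (applyUpTo suc B) (box B m) x∷v∈
... | _ , _ , x∈ , v∈ , refl = ∈-applyUpTo⁻ suc x∈ , v∈

∈-box-++⁻ˡ : ∀ {B m n} (u : Vec ℕ m) {w : Vec ℕ n} → u Vec.++ w ∈ box B (m + n) → u ∈ box B m
∈-box-++⁻ˡ []      _ = here refl
∈-box-++⁻ˡ {B} (x ∷ u) x∷uw∈ with ∈-box-∷⁻ {B} x∷uw∈
... | (i , i<B , refl) , uw∈ = ∈-cartesianProductWith⁺ _∷_ (∈-applyUpTo⁺ suc i<B) (∈-box-++⁻ˡ {B} u uw∈)

-- A covering list may repeat solutions or contain non-solutions, so a parametrisation need not be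
-- injective to bound the count.
solutionCount-≤ : ∀ k B ys → (∀ {v} → v ∈ box B (2 * (k + 1)) → IsSolution k v → v ∈ ys) →
  solutionCount k B ≤ length ys
solutionCount-≤ k B ys covers = unique∧⊆⇒length≤
  (Unique.filter⁺ (isSolution? k) (box-unique B (2 * (k + 1))))
  (λ v∈ → uncurry covers (∈-filter⁻ (isSolution? k) v∈))

length-cartesianProductWith : ∀ {A B C : Set} (f : A → B → C) xs ys →
  length (cartesianProductWith f xs ys) ≡ length xs * length ys
length-cartesianProductWith f []       ys = refl
length-cartesianProductWith f (x ∷ xs) ys = trans (length-++ (map (f x) ys))
  (cong₂ _+_ (length-map (f x) ys) (length-cartesianProductWith f xs ys))

length-concat-applyUpTo : ∀ {A : Set} (f : ℕ → List A) n →
  length (concat (applyUpTo f n)) ≡ sum (applyUpTo (length ∘ f) n)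
length-concat-applyUpTo f zero    = refl
length-concat-applyUpTo f (suc n) = trans (length-++ (f 0))
  (cong (length (f 0) +_) (length-concat-applyUpTo (f ∘ suc) n))

sum-applyUpTo-1 : ∀ n → sum (applyUpTo (const 1) n) ≡ n
sum-applyUpTo-1 zero    = refl
sum-applyUpTo-1 (suc n) = cong suc (sum-applyUpTo-1 n)

-- Termwise comparison with ratio d / c, denominator cleared. Going from `m` to `n` only adds
-- nonnegative terms on the right.
sum-applyUpTo-≤ : ∀ c d (f g : ℕ → ℕ) {m n} → m ≤ n → (∀ i → i < m → c * f i ≤ d * g i) →
  c * sum (applyUpTo f m) ≤ d * sum (applyUpTo g n)
sum-applyUpTo-≤ c d f g {n = n} z≤n f≤g = subst (_≤ d * sum (applyUpTo g n)) (sym (*-zeroʳ c)) z≤n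
sum-applyUpTo-≤ c d f g {suc m} {suc n} (s≤s m≤n) f≤g = begin
  c * (f 0 + sum (applyUpTo (f ∘ suc) m))      ≡⟨ *-distribˡ-+ c (f 0) _ ⟩
  c * f 0 + c * sum (applyUpTo (f ∘ suc) m)
    ≤⟨ +-mono-≤ (f≤g 0 (s≤s z≤n)) (sum-applyUpTo-≤ c d (f ∘ suc) (g ∘ suc) m≤n (λ i i<m → f≤g (suc i) (s≤s i<m))) ⟩
  d * g 0 + d * sum (applyUpTo (g ∘ suc) n)    ≡⟨ *-distribˡ-+ d (g 0) _ ⟨
  d * (g 0 + sum (applyUpTo (g ∘ suc) n))      ∎
  where open ≤-Reasoning

*≤⇒≤/ : ∀ m n o .{{_ : NonZero n}} → m * n ≤ o → m ≤ o / n
*≤⇒≤/ m n o m*n≤o = subst (_≤ o / n) (m*n/n≡m m n) (/-monoˡ-≤ n m*n≤o)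

-- Refining two factorisations of the same number

-- Let g = gcd(x, a), x = g x′ and a = g a′. Cancelling g leaves x′ p = a′ n; as x′ and a′ are
-- coprime, x′ divides n, with quotient n′.
*-refine : ∀ {x p a n} → {{NonZero x}} → x * p ≡ a * n →
  ∃ λ g → ∃ λ x′ → ∃ λ a′ → ∃ λ n′ → x ≡ g * x′ × a ≡ g * a′ × n ≡ x′ * n′ × p ≡ a′ * n′
*-refine {x} {p} {a} {n} xp≡an = g , x′ , a′ , refine (coprime-divisor (coprime-/gcd x a) x′∣a′n)
  where
  g = gcd x a
  instance
    g≢0 : NonZero g
    g≢0 = ≢-nonZero (gcd[m,n]≢0 x a (inj₁ (≢-nonZero⁻¹ x)))
  x′ = x / g
  a′ = a / g
  x≡ : x ≡ g * x′
  x≡ = sym (m*[n/m]≡n (gcd[m,n]∣m x a))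
  a≡ : a ≡ g * a′
  a≡ = sym (m*[n/m]≡n (gcd[m,n]∣n x a))
  x′p≡a′n : x′ * p ≡ a′ * n
  x′p≡a′n = *-cancelˡ-≡ _ _ g (begin
    g * (x′ * p)  ≡⟨ *-assoc g x′ p ⟨
    g * x′ * p    ≡⟨ cong (_* p) x≡ ⟨
    x * p         ≡⟨ xp≡an ⟩
    a * n         ≡⟨ cong (_* n) a≡ ⟩
    g * a′ * n    ≡⟨ *-assoc g a′ n ⟩
    g * (a′ * n)  ∎)
    where open ≡-Reasoning
  instance
    x′≢0 : NonZero x′
    x′≢0 = m*n≢0⇒n≢0 g {{subst NonZero x≡ it}}
  x′∣a′n : x′ ∣ a′ * n
  x′∣a′n = subst (x′ ∣_) x′p≡a′n (m∣m*n p)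
  refine : x′ ∣ n → ∃ λ n′ → x ≡ g * x′ × a ≡ g * a′ × n ≡ x′ * n′ × p ≡ a′ * n′
  refine (divides n′ n≡) = n′ , x≡ , a≡ , n≡x′n′ , *-cancelˡ-≡ _ _ x′ (begin
    x′ * p          ≡⟨ x′p≡a′n ⟩
    a′ * n          ≡⟨ cong (a′ *_) n≡x′n′ ⟩
    a′ * (x′ * n′)  ≡⟨ x∙yz≈y∙xz a′ x′ n′ ⟩
    x′ * (a′ * n′)  ∎)
    where
    open ≡-Reasoning
    n≡x′n′ : n ≡ x′ * n′
    n≡x′n′ = trans n≡ (*-comm n′ x′)

-- Induction on `w`: `*-refine` splits the head as g x′, where g goes to `s` and x′ to `t`. The
-- remaining cofactors a′ of a and n′ of n multiply to the product of the tail.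
prod-split : ∀ {m} (w : Vec ℕ m) {a n} → {{NonZero (prod w)}} → prod w ≡ a * n →
  ∃ λ s → ∃ λ t → prod s ≡ a × prod t ≡ n × w ≡ zipWith _*_ s t
prod-split [] {a} {n} 1≡an = [] , [] , sym (m*n≡1⇒m≡1 a n (sym 1≡an)) , sym (m*n≡1⇒n≡1 a n (sym 1≡an)) , refl
prod-split (x ∷ w) {a} {n} xw≡an
  with *-refine {x} {prod w} {a} {n} {{m*n≢0⇒m≢0 x}} xw≡an
... | g , x′ , a′ , n′ , refl , refl , refl , w≡a′n′
  with prod-split w {a′} {n′} {{m*n≢0⇒n≢0 (g * x′)}} w≡a′n′
... | s , t , refl , refl , refl = g ∷ s , x′ ∷ t , refl , refl , refl

-- Solutions are products of matrices

-- For positive `X`, the tuples of positive integers with product at most `X`. Sorting by the first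
-- entry makes the length a sum over `i`, ready for comparison with a harmonic sum.
tuples : ∀ j → ℕ → List (Vec ℕ j)
tuples zero    X = [] ∷ []
tuples (suc j) X = concat (applyUpTo (λ i → map (suc i ∷_) (tuples j (X / suc i))) X)

∈-tuples : ∀ {j X} (v : Vec ℕ j) → {{NonZero (prod v)}} → prod v ≤ X → v ∈ tuples j X
∈-tuples []           _   = here refl
-- A zero entry would make the product zero, against `NonZero`, so it gets no clause.
∈-tuples {suc j} {X} (suc i ∷ v) v≤X = ∈-concat⁺′
  (∈-map⁺ (suc i ∷_) (∈-tuples v {{v≢0}} (*≤⇒≤/ (prod v) (suc i) X (subst (_≤ X) (*-comm (suc i) (prod v)) v≤X))))
  (∈-applyUpTo⁺ (λ i → map (suc i ∷_) (tuples j (X / suc i))) (≤-trans (m≤m*n (suc i) (prod v) {{v≢0}}) v≤X))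
  where
  v≢0 : NonZero (prod v)
  v≢0 = m*n≢0⇒n≢0 (suc i)

-- The row and column products of the a × b matrices with row products at most B.
margins : ℕ → ∀ a b → List (Vec ℕ a × Vec ℕ b)
margins B zero    b = ([] , replicate b 1) ∷ []
margins B (suc a) b = cartesianProductWith (λ s (u , w) → prod s ∷ u , zipWith _*_ s w)
  (tuples b B) (margins B a b)

length-margins : ∀ B a b → length (margins B a b) ≡ length (tuples b B) ^ a
length-margins B zero    b = refl
length-margins B (suc a) b = trans (length-cartesianProductWith _ (tuples b B) (margins B a b))
  (cong (length (tuples b B) *_) (length-margins B a b))

prod≡1⇒≡replicate : ∀ {m} (w : Vec ℕ m) → prod w ≡ 1 → w ≡ replicate m 1
prod≡1⇒≡replicate []      _   = refl
prod≡1⇒≡replicate (x ∷ w) p≡1 =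
  cong₂ _∷_ (m*n≡1⇒m≡1 x (prod w) p≡1) (prod≡1⇒≡replicate w (m*n≡1⇒n≡1 x (prod w) p≡1))

box-prod≢0 : ∀ {B m} (u : Vec ℕ m) → u ∈ box B m → NonZero (prod u)
box-prod≢0 []      _ = _
box-prod≢0 {B} (x ∷ u) xu∈ with ∈-box-∷⁻ {B} xu∈
... | (i , _ , refl) , u∈ = m*n≢0 (suc i) (prod u) {{_}} {{box-prod≢0 {B} u u∈}}

-- `prod-split` writes `w` as the entrywise product of a first row `s` with product `x` and the
-- column products `t` of the other rows, which induction supplies. The row is listed because the
-- box bounds `x` by `B`.
∈-margins : ∀ {B a b} (u : Vec ℕ a) (w : Vec ℕ b) → u ∈ box B a → prod u ≡ prod w → (u , w) ∈ margins B a b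
∈-margins []      w _ 1≡w = here (cong ([] ,_) (prod≡1⇒≡replicate w (sym 1≡w)))
∈-margins {B} (x ∷ u) w xu∈ xu≡w
  with prod-split w {x} {prod u} {{subst NonZero xu≡w (box-prod≢0 {B} (x ∷ u) xu∈)}} (sym xu≡w) | ∈-box-∷⁻ {B} xu∈
... | s , t , s≡x , t≡u , refl | (i , i<B , refl) , u∈ =
  subst (λ y → (y ∷ u , zipWith _*_ s t) ∈ margins B _ _) s≡x
    (∈-cartesianProductWith⁺ _ (∈-tuples s {{subst NonZero (sym s≡x) _}} (subst (_≤ B) (sym s≡x) i<B))
      (∈-margins {B} u t u∈ (sym t≡u)))

-- Row products form the first half of a solution, column products the second. `2 * (k + 1)` unfolds
-- to `(k + 1) + (k + 1 + 0)`, whence the length of the second half.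
solutionCount-≤-margins : ∀ k B → solutionCount k B ≤ length (tuples (k + 1 + 0) B) ^ (k + 1)
solutionCount-≤-margins k B = begin
  solutionCount k B                                       ≤⟨ solutionCount-≤ k B (map (uncurry Vec._++_) M) covers ⟩
  length (map (uncurry Vec._++_) M)                       ≡⟨ length-map (uncurry Vec._++_) M ⟩
  length M                                                ≡⟨ length-margins B (k + 1) (k + 1 + 0) ⟩
  length (tuples (k + 1 + 0) B) ^ (k + 1)                 ∎
  where
  open ≤-Reasoning
  M = margins B (k + 1) (k + 1 + 0)
  covers : ∀ {v} → v ∈ box B (2 * (k + 1)) → IsSolution k v → v ∈ map (uncurry Vec._++_) M
  covers {v} v∈ sol = subst (_∈ map (uncurry Vec._++_) M) (take++drop≡id (k + 1) v)
    (∈-map⁺ (uncurry Vec._++_) (∈-margins {B} (take (k + 1) v) (drop (k + 1) v)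
      (∈-box-++⁻ˡ {B} (take (k + 1) v) (subst (_∈ box B (2 * (k + 1))) (sym (take++drop≡id (k + 1) v)) v∈)) sol))

-- The case k = 1: parametrising ab = cd

quadruple : ℕ → ℕ → ℕ × ℕ → Vec ℕ 4
quadruple x y (g , h) = g * x ∷ y * h ∷ g * y ∷ x * h ∷ []

-- The argument ranging up to `M` is the smaller of x and y, and `f` decides which of the two it is;
-- the pair is (g, h).
quadruplesWith : (ℕ → ℕ × ℕ → Vec ℕ 4) → ℕ → ℕ → List (Vec ℕ 4)
quadruplesWith f M q = cartesianProductWith f (applyUpTo suc M) (cartesianProduct (applyUpTo suc q) (applyUpTo suc q))

length-quadruplesWith : ∀ f M q → length (quadruplesWith f M q) ≡ M * (q * q)
length-quadruplesWith f M q = trans (length-cartesianProductWith f (applyUpTo suc M) _)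
  (cong₂ _*_ (length-applyUpTo suc M) (trans (length-cartesianProductWith _,_ (applyUpTo suc q) (applyUpTo suc q))
    (cong₂ _*_ (length-applyUpTo suc q) (length-applyUpTo suc q))))

-- The quadruples (gx, yh, gy, xh) with max(x, y) = suc i and g, h ≤ B / suc i.
quadruplesAt : ℕ → ℕ → List (Vec ℕ 4)
quadruplesAt B i = quadruplesWith (λ t → quadruple t (suc i)) (suc i) (B / suc i)
                ++ quadruplesWith (λ t → quadruple (suc i) t) (suc i) (B / suc i)

length-quadruplesAt : ∀ B i → length (quadruplesAt B i) ≡ 2 * (suc i * (B / suc i * (B / suc i)))
length-quadruplesAt B i = trans (length-++ (quadruplesWith (λ t → quadruple t (suc i)) (suc i) (B / suc i)))
  (cong₂ _+_ (length-quadruplesWith _ (suc i) (B / suc i))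
    (trans (length-quadruplesWith _ (suc i) (B / suc i)) (sym (+-identityʳ _))))

quadruples : ℕ → List (Vec ℕ 4)
quadruples B = concat (applyUpTo (quadruplesAt B) B)

∈-applyUpTo-suc : ∀ {x n} → NonZero x → x ≤ n → x ∈ applyUpTo suc n
∈-applyUpTo-suc {suc i} _ i<n = ∈-applyUpTo⁺ suc i<n

-- After `*-refine`, all of gx, gy, xh and yh are at most `B`, so g and h are at most B / max(x, y).
-- Also max(x, y) ≤ B because g ≥ 1.
∈-quadruples : ∀ {B} v → v ∈ box B 4 → IsSolution 1 v → v ∈ quadruples B
∈-quadruples {B} (a ∷ b ∷ c ∷ d ∷ []) v∈ sol
  with ∈-box-∷⁻ {B} v∈
... | (_ , a≤B , refl) , v∈
  with ∈-box-∷⁻ {B} v∈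
... | (_ , b≤B , refl) , v∈
  with ∈-box-∷⁻ {B} v∈
... | (_ , c≤B , refl) , v∈
  with ∈-box-∷⁻ {B} v∈
... | (_ , d≤B , refl) , _
  with *-refine {a} {b} {c} {d} (subst₂ (λ x y → a * x ≡ c * y) (*-identityʳ b) (*-identityʳ d) sol)
... | g , x , y , h , a≡gx , c≡gy , d≡xh , b≡yh
  = subst₂ (λ p q → p ∷ q ∈ quadruples B) (sym a≡gx) (cong₂ _∷_ (sym b≡yh) (cong₂ _∷_ (sym c≡gy) (cong (_∷ []) (sym d≡xh))))
    (cover g x y h (subst NonZero a≡gx _) (subst NonZero b≡yh _)
      (subst (_≤ B) a≡gx a≤B) (subst (_≤ B) c≡gy c≤B) (subst (_≤ B) d≡xh d≤B) (subst (_≤ B) b≡yh b≤B))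
  where
  cover : ∀ g x y h → NonZero (g * x) → NonZero (y * h) →
    g * x ≤ B → g * y ≤ B → x * h ≤ B → y * h ≤ B →
    quadruple x y (g , h) ∈ quadruples B
  -- Neither x nor y is zero, as each divides a positive number. `zero * h` reduces, while
  -- `g * zero` has to be rewritten.
  cover g x zero    h gx≢0 ()   gx≤B gy≤B xh≤B yh≤B
  cover g zero y    h gx≢0 yh≢0 gx≤B gy≤B xh≤B yh≤B = contradiction (*-zeroʳ g) (≢-nonZero⁻¹ _ {{gx≢0}})
  cover g x@(suc i) y@(suc j) h gx≢0 yh≢0 gx≤B gy≤B xh≤B yh≤B with ≤-total x y
  ... | inj₁ x≤y = ∈-concat⁺′
    (∈-++⁺ˡ (∈-cartesianProductWith⁺ (λ t → quadruple t y) (∈-applyUpTo-suc _ x≤y)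
      (∈-cartesianProductWith⁺ _,_ (∈-applyUpTo-suc g≢0 (*≤⇒≤/ g y B gy≤B))
        (∈-applyUpTo-suc h≢0 (*≤⇒≤/ h y B (subst (_≤ B) (*-comm y h) yh≤B))))))
    (∈-applyUpTo⁺ (quadruplesAt B) (≤-trans (m≤n*m y g {{g≢0}}) gy≤B))
    where
    g≢0 = m*n≢0⇒m≢0 g {x} {{gx≢0}}
    h≢0 = m*n≢0⇒n≢0 y {h} {{yh≢0}}
  ... | inj₂ y≤x = ∈-concat⁺′
    (∈-++⁺ʳ (quadruplesWith (λ t → quadruple t x) x (B / x)) (∈-cartesianProductWith⁺ (quadruple x) (∈-applyUpTo-suc _ y≤x)
      (∈-cartesianProductWith⁺ _,_ (∈-applyUpTo-suc g≢0 (*≤⇒≤/ g x B gx≤B))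
        (∈-applyUpTo-suc h≢0 (*≤⇒≤/ h x B (subst (_≤ B) (*-comm x h) xh≤B))))))
    (∈-applyUpTo⁺ (quadruplesAt B) (≤-trans (m≤n*m x g {{g≢0}}) gx≤B))
    where
    g≢0 = m*n≢0⇒m≢0 g {x} {{gx≢0}}
    h≢0 = m*n≢0⇒n≢0 y {h} {{yh≢0}}

-- Counting bounds over the common denominator B !

weight : ℕ → ℕ → ℕ
weight B i = B ! / suc i

-- This is `B !` times the harmonic number of `B`: every `suc i` with `i < B` divides `B !`, so the
-- divisions in `weight` are exact.
harmonic : ℕ → ℕ
harmonic B = sum (applyUpTo (weight B) B)

weight*suc : ∀ {B i} → i < B → weight B i * suc i ≡ B !
weight*suc {B} {i} i<B = m/n*n≡m (∣-trans (m∣m*n (i !)) (m≤n⇒m!∣n! i<B))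

!≤harmonic : ∀ {B} → 1 ≤ B → B ! ≤ harmonic B
!≤harmonic {suc B} _ = ≤-trans
  (≤-reflexive (trans (sym (weight*suc {suc B} {0} (s≤s z≤n))) (*-identityʳ _)))
  (m≤m+n (weight (suc B) 0) _)

-- In terms of H = `harmonic B` / `B !`, the count is at most X H^j: summing (X / (i + 1)) H^j over
-- the first entry i + 1 gives one more factor H. `B` stays fixed while `X` shrinks, which keeps the
-- denominator common.
tuples-≤ : ∀ B j {X} → X ≤ B → (B !) ^ j * length (tuples (suc j) X) ≤ X * harmonic B ^ j
tuples-≤ B zero {X} _ = begin
  1 * length (tuples 1 X)                            ≡⟨ cong (1 *_) (length-concat-applyUpTo rows X) ⟩
  1 * sum (applyUpTo (length ∘ rows) X)
    ≤⟨ sum-applyUpTo-≤ 1 1 (length ∘ rows) (const 1) {X} ≤-refl (λ _ _ → ≤-refl) ⟩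
  1 * sum (applyUpTo (const 1) X)                    ≡⟨ *-identityˡ _ ⟩
  sum (applyUpTo (const 1) X)                        ≡⟨ sum-applyUpTo-1 X ⟩
  X                                                  ≡⟨ *-identityʳ X ⟨
  X * 1                                              ∎
  where
  open ≤-Reasoning
  rows : ℕ → List (Vec ℕ 1)
  rows i = map (suc i ∷_) (tuples 0 (X / suc i))
tuples-≤ B (suc j) {X} X≤B = begin
  D * D ^ j * length (tuples (suc (suc j)) X)        ≡⟨ cong (D * D ^ j *_) (length-concat-applyUpTo rows X) ⟩
  D * D ^ j * sum (applyUpTo (length ∘ rows) X)      ≤⟨ sum-applyUpTo-≤ (D * D ^ j) (X * h ^ j) (length ∘ rows) (weight B) X≤B bound ⟩
  X * h ^ j * h                                      ≡⟨ *-assoc X (h ^ j) h ⟩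
  X * (h ^ j * h)                                    ≡⟨ cong (X *_) (*-comm (h ^ j) h) ⟩
  X * (h * h ^ j)                                    ∎
  where
  open ≤-Reasoning
  D = B !
  h = harmonic B
  rows : ℕ → List (Vec ℕ (suc (suc j)))
  rows i = map (suc i ∷_) (tuples (suc j) (X / suc i))
  bound : ∀ i → i < X → D * D ^ j * length (rows i) ≤ X * h ^ j * weight B i
  bound i i<X = begin
    D * D ^ j * length (rows i)           ≡⟨ cong (D * D ^ j *_) (length-map (suc i ∷_) (tuples (suc j) q)) ⟩
    D * D ^ j * length (tuples (suc j) q) ≡⟨ *-assoc D (D ^ j) _ ⟩
    D * (D ^ j * length (tuples (suc j) q))
      ≤⟨ *-monoʳ-≤ D (tuples-≤ B j (≤-trans (m/n≤m X (suc i)) X≤B)) ⟩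
    -- One factor `B !` becomes `w * suc i`: `suc i` is absorbed by `q * suc i` ≤ `X`, and `w`
    -- remains as a term of `harmonic B`.
    D * (q * h ^ j)                       ≡⟨ cong (_* (q * h ^ j)) (weight*suc {B} (<-≤-trans i<X X≤B)) ⟨
    w * suc i * (q * h ^ j)               ≡⟨ solve 4 (λ w s q p → w :* s :* (q :* p) := (q :* s) :* (p :* w)) refl w (suc i) q (h ^ j) ⟩
    q * suc i * (h ^ j * w)               ≤⟨ *-monoˡ-≤ (h ^ j * w) (m/n*n≤m X (suc i)) ⟩
    X * (h ^ j * w)                       ≡⟨ *-assoc X (h ^ j) w ⟨
    X * h ^ j * w                         ∎
    where
    open +-*-Solver
    q = X / suc i
    w = weight B i

-- The quadruples with maximum i + 1 number at most 2 (i + 1) (B / (i + 1))² = 2 B² / (i + 1), a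
-- single harmonic term.
quadruples-≤ : ∀ B → B ! * length (quadruples B) ≤ 2 * (B * B) * harmonic B
quadruples-≤ B = begin
  B ! * length (quadruples B)                          ≡⟨ cong (B ! *_) (length-concat-applyUpTo (quadruplesAt B) B) ⟩
  B ! * sum (applyUpTo (length ∘ quadruplesAt B) B)
    ≤⟨ sum-applyUpTo-≤ (B !) (2 * (B * B)) (length ∘ quadruplesAt B) (weight B) {B} ≤-refl bound ⟩
  2 * (B * B) * harmonic B                             ∎
  where
  open ≤-Reasoning
  bound : ∀ i → i < B → B ! * length (quadruplesAt B i) ≤ 2 * (B * B) * weight B i
  bound i i<B = begin
    B ! * length (quadruplesAt B i)                ≡⟨ cong₂ _*_ (sym (weight*suc {B} i<B)) (length-quadruplesAt B i) ⟩
    w * suc i * (2 * (suc i * (q * q)))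
      ≡⟨ solve 3 (λ w s q → w :* s :* (con 2 :* (s :* (q :* q))) := con 2 :* ((q :* s) :* (q :* s)) :* w) refl w (suc i) q ⟩
    2 * (q * suc i * (q * suc i)) * w              ≤⟨ *-monoˡ-≤ w (*-monoʳ-≤ 2 (*-mono-≤ q*s≤B q*s≤B)) ⟩
    2 * (B * B) * w                                ∎
    where
    open +-*-Solver
    q = B / suc i
    w = weight B i
    q*s≤B = m/n*n≤m B (suc i)

^-distribʳ-* : ∀ m n j → (m * n) ^ j ≡ m ^ j * n ^ j
^-distribʳ-* m n zero    = refl
^-distribʳ-* m n (suc j) = trans (cong (m * n *_) (^-distribʳ-* m n j)) ([m*n]*[o*p]≡[m*o]*[n*p] m n (m ^ j) (n ^ j))

-- For k ≥ 2 the matrices give k² + k factors harmonic B / B ! ≥ 1; the exponent allows k - 2 more.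
solutionCount-≤-harmonic : ∀ k B → 1 ≤ k → 1 ≤ B →
  (B !) ^ (k ^ 2 + 2 * k ∸ 2) * solutionCount k B ≤ 2 * B ^ (k + 1) * harmonic B ^ (k ^ 2 + 2 * k ∸ 2)
solutionCount-≤-harmonic 1 B _ _ = begin
  (B !) ^ 1 * solutionCount 1 B               ≡⟨ cong (_* solutionCount 1 B) (^-identityʳ (B !)) ⟩
  B ! * solutionCount 1 B                     ≤⟨ *-monoʳ-≤ (B !) (solutionCount-≤ 1 B (quadruples B) (λ {v} → ∈-quadruples {B} v)) ⟩
  B ! * length (quadruples B)                 ≤⟨ quadruples-≤ B ⟩
  2 * (B * B) * harmonic B
    ≡⟨ cong₂ (λ x y → 2 * (B * x) * y) (sym (*-identityʳ B)) (sym (^-identityʳ (harmonic B))) ⟩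
  2 * B ^ 2 * harmonic B ^ 1                  ∎
  where open ≤-Reasoning
solutionCount-≤-harmonic k@(suc (suc i)) B _ 1≤B = begin
  D ^ e * N                                   ≡⟨ cong (λ z → D ^ z * N) e≡ ⟩
  D ^ (i + j * a) * N                         ≤⟨ *-monoʳ-≤ (D ^ (i + j * a)) (solutionCount-≤-margins k B) ⟩
  D ^ (i + j * a) * T ^ a                     ≡⟨ cong (_* T ^ a) (^-distribˡ-+-* D i (j * a)) ⟩
  D ^ i * D ^ (j * a) * T ^ a                 ≡⟨ *-assoc (D ^ i) _ _ ⟩
  D ^ i * (D ^ (j * a) * T ^ a)               ≡⟨ cong (λ z → D ^ i * (z * T ^ a)) (^-*-assoc D j a) ⟨
  D ^ i * ((D ^ j) ^ a * T ^ a)               ≡⟨ cong (D ^ i *_) (^-distribʳ-* (D ^ j) T a) ⟨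
  -- The i = k - 2 surplus factors are raised from `B !` to `harmonic B`.
  D ^ i * (D ^ j * T) ^ a                     ≤⟨ *-mono-≤ (^-monoˡ-≤ i (!≤harmonic 1≤B)) (^-monoˡ-≤ a (tuples-≤ B j ≤-refl)) ⟩
  h ^ i * (B * h ^ j) ^ a                     ≡⟨ cong (h ^ i *_) (^-distribʳ-* B (h ^ j) a) ⟩
  h ^ i * (B ^ a * (h ^ j) ^ a)               ≡⟨ cong (λ z → h ^ i * (B ^ a * z)) (^-*-assoc h j a) ⟩
  h ^ i * (B ^ a * h ^ (j * a))               ≡⟨ x∙yz≈y∙xz (h ^ i) (B ^ a) _ ⟩
  B ^ a * (h ^ i * h ^ (j * a))               ≡⟨ cong (B ^ a *_) (^-distribˡ-+-* h i (j * a)) ⟨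
  B ^ a * h ^ (i + j * a)                     ≡⟨ cong (λ z → B ^ a * h ^ z) e≡ ⟨
  B ^ a * h ^ e                               ≤⟨ *-monoˡ-≤ (h ^ e) (m≤m+n (B ^ a) _) ⟩
  2 * B ^ a * h ^ e                           ∎
  where
  open ≤-Reasoning
  D = B !
  h = harmonic B
  N = solutionCount k B
  a = k + 1
  -- Equal to k, and written so that `suc j` is `k + 1 + 0` by definition.
  j = suc i + 1 + 0
  e = k ^ 2 + 2 * k ∸ 2
  T = length (tuples (suc j) B)
  -- This is k² + 2k - 2 = (k - 2) + k (k + 1).
  e≡ : e ≡ i + j * a
  e≡ = trans (cong (_∸ 2) (solve 1 (λ i → (con 2 :+ i) :* ((con 2 :+ i) :* con 1) :+ con 2 :* (con 2 :+ i)
      := (i :+ (con 1 :+ i :+ con 1 :+ con 0) :* (con 2 :+ i :+ con 1)) :+ con 2) refl i)) (m+n∸n≡m _ 2)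
    where open +-*-Solver

-- Rational estimates

natℚ-mono-≤ : ∀ {m n} → m ≤ n → natℚ m ℚ.≤ natℚ n
natℚ-mono-≤ {m} {n} m≤n = ℚ.toℚᵘ-cancel-≤ (begin
  ℚ.toℚᵘ (natℚ m)    ≃⟨ ℚ.toℚᵘ-fromℚᵘ (ℚᵘ.mkℚᵘ (ℤ.+ m) 0) ⟩
  ℚᵘ.mkℚᵘ (ℤ.+ m) 0    ≤⟨ ℚᵘ.*≤* (ℤ.*-monoʳ-≤-nonNeg (ℤ.+ 1) (ℤ.+≤+ m≤n)) ⟩
  ℚᵘ.mkℚᵘ (ℤ.+ n) 0    ≃⟨ ℚ.toℚᵘ-fromℚᵘ (ℚᵘ.mkℚᵘ (ℤ.+ n) 0) ⟨
  ℚ.toℚᵘ (natℚ n)    ∎)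
  where open ℚᵘ.≤-Reasoning

natℚ-+ : ∀ m n → natℚ (m + n) ≡ natℚ m ℚ.+ natℚ n
natℚ-+ zero    n = sym (ℚ.+-identityˡ (natℚ n))
natℚ-+ (suc m) n = begin
  natℚ (suc (m + n))               ≡⟨ natℚ-suc (m + n) ⟩
  1ℚ ℚ.+ natℚ (m + n)              ≡⟨ cong (1ℚ ℚ.+_) (natℚ-+ m n) ⟩
  1ℚ ℚ.+ (natℚ m ℚ.+ natℚ n)       ≡⟨ ℚ.+-assoc 1ℚ (natℚ m) (natℚ n) ⟨
  1ℚ ℚ.+ natℚ m ℚ.+ natℚ n         ≡⟨ cong (ℚ._+ natℚ n) (natℚ-suc m) ⟨
  natℚ (suc m) ℚ.+ natℚ n          ∎
  where open ≡-Reasoning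

natℚ-* : ∀ m n → natℚ (m * n) ≡ natℚ m ℚ.* natℚ n
natℚ-* zero    n = sym (ℚ.*-zeroˡ (natℚ n))
natℚ-* (suc m) n = begin
  natℚ (n + m * n)                     ≡⟨ natℚ-+ n (m * n) ⟩
  natℚ n ℚ.+ natℚ (m * n)              ≡⟨ cong₂ ℚ._+_ (sym (ℚ.*-identityˡ (natℚ n))) (natℚ-* m n) ⟩
  1ℚ ℚ.* natℚ n ℚ.+ natℚ m ℚ.* natℚ n  ≡⟨ ℚ.*-distribʳ-+ (natℚ n) 1ℚ (natℚ m) ⟨
  (1ℚ ℚ.+ natℚ m) ℚ.* natℚ n           ≡⟨ cong (ℚ._* natℚ n) (natℚ-suc m) ⟨
  natℚ (suc m) ℚ.* natℚ n              ∎
  where open ≡-Reasoning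

natℚ-^ : ∀ m n → natℚ (m ^ n) ≡ natℚ m ^ℚ n
natℚ-^ m zero    = refl
natℚ-^ m (suc n) = trans (natℚ-* m (m ^ n)) (cong (natℚ m ℚ.*_) (natℚ-^ m n))

natℚ-nonNeg : ∀ n → ℚ.NonNegative (natℚ n)
natℚ-nonNeg n = ℚ.normalize-nonNeg n 1

^ℚ-nonNeg : ∀ {p} → ℚ.NonNegative p → ∀ n → ℚ.NonNegative (p ^ℚ n)
^ℚ-nonNeg     p≥0 zero    = _
^ℚ-nonNeg {p} p≥0 (suc n) = ℚ.nonNeg*nonNeg⇒nonNeg p {{p≥0}} (p ^ℚ n) {{^ℚ-nonNeg p≥0 n}}

^ℚ-mono-≤ : ∀ {p q} → ℚ.NonNegative p → p ℚ.≤ q → ∀ n → p ^ℚ n ℚ.≤ q ^ℚ n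
^ℚ-mono-≤         p≥0 p≤q zero    = ℚ.≤-refl
^ℚ-mono-≤ {p} {q} p≥0 p≤q (suc n) = ℚ.≤-trans
  (ℚ.*-monoʳ-≤-nonNeg (p ^ℚ n) {{^ℚ-nonNeg p≥0 n}} p≤q)
  (ℚ.*-monoˡ-≤-nonNeg q {{ℚ.nonNegative (ℚ.≤-trans (ℚ.nonNegative⁻¹ p {{p≥0}}) p≤q)}} (^ℚ-mono-≤ p≥0 p≤q n))

≤-+-nonNeg : ∀ {p q} → 0ℚ ℚ.≤ q → p ℚ.≤ p ℚ.+ q
≤-+-nonNeg {p} {q} 0≤q = subst (ℚ._≤ p ℚ.+ q) (ℚ.+-identityʳ p) (ℚ.+-monoʳ-≤ p 0≤q)

-- Passage to real numbers and the logarithm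

seq-^ᵣ : ∀ x n m → seq (x ^ᵣ n) m ≡ seq x m ^ℚ n
seq-^ᵣ x zero    m = refl
seq-^ᵣ x (suc n) m = cong (seq x m ℚ.*_) (seq-^ᵣ x n m)

-- The threshold 0 serves for every ε, so the final inequality can be proved index by index over the
-- rationals.
≤-pointwise⇒≤ᵣ : ∀ {x y} → (∀ m → seq x m ℚ.≤ seq y m) → x ≤ᵣ y
≤-pointwise⇒≤ᵣ {x} {y} x≤y ε 0<ε = 0 , λ m _ →
  ℚ.≤-trans (x≤y m) (≤-+-nonNeg (ℚ.<⇒≤ 0<ε))

-- The offset `a` is there for the induction: `applyUpTo` unfolds at the front but `reciprocalSum`
-- at the back, and `reciprocalSum-suc` shifts the offset.
sum≡*reciprocalSum : ∀ D f a l → (∀ i → i < l → f i * suc (a + i) ≡ D) →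
  natℚ (sum (applyUpTo f l)) ≡ natℚ D ℚ.* reciprocalSum a l
sum≡*reciprocalSum D f a zero    _  = sym (ℚ.*-zeroʳ (natℚ D))
sum≡*reciprocalSum D f a (suc l) f≡ = begin
  natℚ (f 0 + sum (applyUpTo (f ∘ suc) l))              ≡⟨ natℚ-+ (f 0) _ ⟩
  natℚ (f 0) ℚ.+ natℚ (sum (applyUpTo (f ∘ suc) l))     ≡⟨ cong₂ ℚ._+_ head tail ⟩
  natℚ D ℚ.* unitFraction a ℚ.+ natℚ D ℚ.* reciprocalSum (suc a) l
                                                        ≡⟨ ℚ.*-distribˡ-+ (natℚ D) (unitFraction a) (reciprocalSum (suc a) l) ⟨
  natℚ D ℚ.* (unitFraction a ℚ.+ reciprocalSum (suc a) l) ≡⟨ cong (natℚ D ℚ.*_) (reciprocalSum-suc a l) ⟨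
  natℚ D ℚ.* reciprocalSum a (suc l)                    ∎
  where
  open ≡-Reasoning
  head : natℚ (f 0) ≡ natℚ D ℚ.* unitFraction a
  head = begin
    natℚ (f 0)                                         ≡⟨ ℚ.*-identityʳ (natℚ (f 0)) ⟨
    natℚ (f 0) ℚ.* unitFraction 0                      ≡⟨ cong (natℚ (f 0) ℚ.*_) (natℚ*unitFraction 0 (suc a) a (sym (*-identityʳ (suc a)))) ⟨
    natℚ (f 0) ℚ.* (natℚ (suc a) ℚ.* unitFraction a)   ≡⟨ ℚ.*-assoc (natℚ (f 0)) (natℚ (suc a)) (unitFraction a) ⟨
    natℚ (f 0) ℚ.* natℚ (suc a) ℚ.* unitFraction a     ≡⟨ cong (ℚ._* unitFraction a) (natℚ-* (f 0) (suc a)) ⟨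
    natℚ (f 0 * suc a) ℚ.* unitFraction a              ≡⟨ cong (λ z → natℚ z ℚ.* unitFraction a) (trans (cong (λ b → f 0 * suc b) (sym (+-identityʳ a))) (f≡ 0 (s≤s z≤n))) ⟩
    natℚ D ℚ.* unitFraction a                          ∎
  tail : natℚ (sum (applyUpTo (f ∘ suc) l)) ≡ natℚ D ℚ.* reciprocalSum (suc a) l
  tail = sum≡*reciprocalSum D (f ∘ suc) (suc a) l
    (λ i i<l → trans (cong (λ b → f (suc i) * suc b) (sym (+-suc a i))) (f≡ (suc i) (s≤s i<l)))

unitFraction≤reciprocalSum : ∀ a l → unitFraction a ℚ.≤ reciprocalSum a (suc l)
unitFraction≤reciprocalSum a zero = ℚ.≤-reflexive
  (sym (trans (ℚ.+-identityˡ _) (cong unitFraction (+-identityʳ a))))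
unitFraction≤reciprocalSum a (suc l) = ℚ.≤-trans (unitFraction≤reciprocalSum a l)
  (≤-+-nonNeg (ℚ.nonNegative⁻¹ _ {{ℚ.normalize-nonNeg 1 (suc (a + suc l))}}))

-- At mesh 1 the lower sum is 1/2 + ⋯ + 1/B, and refinement from mesh 1 does not decrease it.
½≤lowerSum : ∀ {B} → 2 ≤ B → ∀ m → ℚ.½ ℚ.≤ lowerSum B (suc m)
½≤lowerSum {suc (suc b)} (s≤s (s≤s _)) m = ℚ.≤-trans (unitFraction≤reciprocalSum 1 (b + 0))
  (subst (λ M → lowerSum (suc (suc b)) 1 ℚ.≤ lowerSum (suc (suc b)) M) (+-comm m 1) (lowerSum-mono (suc (suc b)) 1 m))

-- In H = 1 + (1/2 + ⋯ + 1/B) the bracket is the lower sum of mesh 1, at most `L`, and 1 is twice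
-- 1/2, at most 2 `L`.
harmonic-≤-log : ∀ {B} → 2 ≤ B → ∀ m → natℚ (harmonic B) ℚ.≤ natℚ (B !) ℚ.* (natℚ 3 ℚ.* seq (log B) m)
harmonic-≤-log {B@(suc (suc b))} 2≤B@(s≤s (s≤s _)) m = begin
  natℚ (harmonic B)                       ≡⟨ sum≡*reciprocalSum (B !) (weight B) 0 B (λ i → weight*suc {B}) ⟩
  natℚ (B !) ℚ.* reciprocalSum 0 B        ≤⟨ ℚ.*-monoˡ-≤-nonNeg (natℚ (B !)) {{natℚ-nonNeg (B !)}} H≤3L ⟩
  natℚ (B !) ℚ.* (natℚ 3 ℚ.* L)           ∎
  where
  open ℚ.≤-Reasoning
  L = lowerSum B (suc m)
  H≤3L : reciprocalSum 0 B ℚ.≤ natℚ 3 ℚ.* L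
  H≤3L = begin
    reciprocalSum 0 B                     ≡⟨ reciprocalSum-suc 0 (suc b) ⟩
    -- The first term `unitFraction 0` is 1, which evaluates to the sum of two halves.
    (ℚ.½ ℚ.+ ℚ.½) ℚ.+ reciprocalSum 1 (suc b)
                                          ≡⟨ cong (λ l → (ℚ.½ ℚ.+ ℚ.½) ℚ.+ reciprocalSum 1 l) (+-identityʳ (suc b)) ⟨
    (ℚ.½ ℚ.+ ℚ.½) ℚ.+ lowerSum B 1
      ≤⟨ ℚ.+-mono-≤ (ℚ.+-mono-≤ (½≤lowerSum 2≤B m) (½≤lowerSum 2≤B m))
           (subst (λ M → lowerSum B 1 ℚ.≤ lowerSum B M) (+-comm m 1) (lowerSum-mono B 1 m)) ⟩
    L ℚ.+ L ℚ.+ L                         ≡⟨ solve 1 (λ l → l :+ l :+ l := con (natℚ 3) :* l) refl L ⟩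
    natℚ 3 ℚ.* L                          ∎
    where open ℚ.+-*-Solver

mainTheorem4 : ∀ (k : ℕ) → 1 ≤ k →
    ∃ λ (C : ℝ) → fromℕ 0 <ᵣ C ×
    (∀ (B : ℕ) → 2 ≤ B →
    fromℕ (solutionCount k B)
    ≤ᵣ C *ᵣ fromℕ B ^ᵣ (k + 1) *ᵣ log B ^ᵣ (k ^ 2 + 2 * k ∸ 2))
-- The 2 comes from the two orders of x and y when k = 1, and 3 ^ e from H ≤ 3 log B.
mainTheorem4 k 1≤k = fromℕ (2 * 3 ^ e) ,
  (1ℚ , ℚ.positive⁻¹ 1ℚ , 0 , λ _ _ → natℚ-mono-≤ {1} (*-mono-≤ {1} {2} (s≤s z≤n) (m^n>0 3 e))) ,
  λ B 2≤B → ≤-pointwise⇒≤ᵣ {fromℕ (solutionCount k B)} {fromℕ (2 * 3 ^ e) *ᵣ fromℕ B ^ᵣ (k + 1) *ᵣ log B ^ᵣ e}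
    (bound B 2≤B)
  where
  e = k ^ 2 + 2 * k ∸ 2
  bound : ∀ B → 2 ≤ B → ∀ m → natℚ (solutionCount k B) ℚ.≤
    natℚ (2 * 3 ^ e) ℚ.* seq (fromℕ B ^ᵣ (k + 1)) m ℚ.* seq (log B ^ᵣ e) m
  -- Multiplying by (B !)^e clears the denominators of H^e, so the counting bound over ℕ applies.
  bound B 2≤B m = ℚ.*-cancelˡ-≤-pos (natℚ D ^ℚ e) {{D^e>0}} (begin
    natℚ D ^ℚ e ℚ.* natℚ N                      ≡⟨ cong (ℚ._* natℚ N) (natℚ-^ D e) ⟨
    natℚ (D ^ e) ℚ.* natℚ N                     ≡⟨ natℚ-* (D ^ e) N ⟨
    natℚ (D ^ e * N)                            ≤⟨ natℚ-mono-≤ (solutionCount-≤-harmonic k B 1≤k (≤-trans (s≤s z≤n) 2≤B)) ⟩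
    natℚ (2 * B ^ (k + 1) * harmonic B ^ e)     ≡⟨ natℚ-* (2 * B ^ (k + 1)) (harmonic B ^ e) ⟩
    natℚ (2 * B ^ (k + 1)) ℚ.* natℚ (harmonic B ^ e)
      ≡⟨ cong₂ ℚ._*_ (trans (natℚ-* 2 (B ^ (k + 1))) (cong (natℚ 2 ℚ.*_) (natℚ-^ B (k + 1)))) (natℚ-^ (harmonic B) e) ⟩
    natℚ 2 ℚ.* b ℚ.* natℚ (harmonic B) ^ℚ e
      ≤⟨ ℚ.*-monoˡ-≤-nonNeg (natℚ 2 ℚ.* b) {{2b≥0}} (^ℚ-mono-≤ (natℚ-nonNeg (harmonic B)) (harmonic-≤-log 2≤B m) e) ⟩
    natℚ 2 ℚ.* b ℚ.* (natℚ D ℚ.* (natℚ 3 ℚ.* L)) ^ℚ e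
      ≡⟨ cong (natℚ 2 ℚ.* b ℚ.*_) (trans (^ℚ-distrib-* (natℚ D) (natℚ 3 ℚ.* L) e)
           (cong (natℚ D ^ℚ e ℚ.*_) (^ℚ-distrib-* (natℚ 3) L e))) ⟩
    natℚ 2 ℚ.* b ℚ.* (natℚ D ^ℚ e ℚ.* (natℚ 3 ^ℚ e ℚ.* L ^ℚ e))
      ≡⟨ solve 5 (λ c b d t l → c :* b :* (d :* (t :* l)) := d :* (c :* t :* b :* l)) refl
           (natℚ 2) b (natℚ D ^ℚ e) (natℚ 3 ^ℚ e) (L ^ℚ e) ⟩
    natℚ D ^ℚ e ℚ.* (natℚ 2 ℚ.* natℚ 3 ^ℚ e ℚ.* b ℚ.* L ^ℚ e)
      ≡⟨ cong (natℚ D ^ℚ e ℚ.*_) (cong₂ ℚ._*_ (cong₂ ℚ._*_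
           (trans (natℚ-* 2 (3 ^ e)) (cong (natℚ 2 ℚ.*_) (natℚ-^ 3 e)))
           (seq-^ᵣ (fromℕ B) (k + 1) m)) (seq-^ᵣ (log B) e m)) ⟨
    natℚ D ^ℚ e ℚ.* (natℚ (2 * 3 ^ e) ℚ.* seq (fromℕ B ^ᵣ (k + 1)) m ℚ.* seq (log B ^ᵣ e) m) ∎)
    where
    open ℚ.≤-Reasoning
    open ℚ.+-*-Solver
    D = B !
    N = solutionCount k B
    L = seq (log B) m
    b = natℚ B ^ℚ (k + 1)
    D^e>0 : ℚ.Positive (natℚ D ^ℚ e)
    D^e>0 = subst ℚ.Positive (natℚ-^ D e) (ℚ.positive (ℚ.<-≤-trans (ℚ.positive⁻¹ 1ℚ)
      (natℚ-mono-≤ {1} (m^n>0 D {{B !≢0}} e))))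
    2b≥0 : ℚ.NonNegative (natℚ 2 ℚ.* b)
    2b≥0 = ℚ.nonNeg*nonNeg⇒nonNeg (natℚ 2) b {{^ℚ-nonNeg (natℚ-nonNeg B) (k + 1)}}
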